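{- Fix a relational schema $\sigma$ and an integer $d\ge 2$. Let $\mathbf C$ be a class of $\sigma$-databases of degree at most $d$ that is closed under removing tuples, and let $\mathbf P\subseteq\mathbf C$ be a property that is hyperfinite on $\mathbf C$. Let $\epsilon\in(0,1]$, and let $r\in\mathbb N$ and $\lambda\in(0,1]$ be such that for every $\mathcal D\in\mathbf P$ and every $\mathcal D'\in\mathbf C$, if $\|\mathrm h_r(\mathcal D)-\mathrm h_r(\mathcal D')\|_1\le\lambda\min\{|D|,|D'|\}$ then $\mathcal D'$ is $\epsilon$-close to $\mathbf P$ in the $\mathrm{BDRD}_{+/- }$ model. Suppose the set $\mathrm h_r(\mathbf P)$ is semilinear. Then there exist $n_{\min},n_{\max}\in\mathbb N$ and $f,\mu\in(0,1)$ such that for every $\mathcal D\in\mathbf C$ with $|D|>n_{\max}$: (1) if $\mathcal D\in\mathbf P$, then there exists $\mathcal D'\in\mathbf P$ with $n_{\min}\le|D'|\le n_{\max}$ and $\|\mathrm{dv}_r(\mathcal D)-\mathrm{dv}_r(\mathcal D')\|_1\le f-\mu$; and (2) if $\mathcal D$ is $\epsilon$-far from $\mathbf P$ in the $\mathrm{BDRD}_{+/- }$ model, then every $\mathcal D'\in\mathbf P$ with $n_{\min}\le|D'|\le n_{\max}$ satisfies $\|\mathrm{dv}_r(\mathcal D)-\mathrm{dv}_r(\mathcal D')\|_1> f+\mu$.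
   Context: A $\sigma$-db $\mathcal D$ has finite domain $D$ and relations $R^{\mathcal D}\subseteq D^{\mathrm{ar}(R)}$ for $R\in\sigma$. The degree of an element is the number of tuples containing it; the degree of $\mathcal D$ is the maximum of these. The Gaifman graph of $\mathcal D$ has vertex set $D$ and an edge between distinct $a,b$ occurring together in some tuple. A property is an isomorphism-closed class of databases. $\mathbf C$ is closed under removing tuples if deleting tuples from a member of $\mathbf C$ yields a member of $\mathbf C$. An $(\epsilon,k)$-partition of a $\sigma$-db on $n$ elements is obtained by removing at most $\epsilon n$ tuples so that every connected component of the Gaifman graph has at most $k$ elements. $\mathbf P\subseteq\mathbf C$ is hyperfinite on $\mathbf C$ if there is a function $\rho$ such that for all $\epsilon\in(0,1]$ and $\mathcal D\in\mathbf P$ some $(\epsilon,\rho(\epsilon))$-partition of $\mathcal D$ lies in $\mathbf C$. For $a\in D$, $N_r(a)$ is the set of elements at Gaifman-distance at most $r$ from $a$; the $r$-neighbourhood of $a$ is $(\mathcal D[N_r(a)],a)$ (induced sub-database with centre $a$). An $r$-type is an isomorphism class (isomorphisms preserving the centre) of $r$-neighbourhoods; there are finitely many, $\mathrm c(r)$, of degree at most $d$. The $r$-histogram $\mathrm h_r(\mathcal D)\in\mathbb N^{\mathrm c(r)}$ counts elements of each $r$-type; the $r$-neighbourhood distribution is $\mathrm{dv}_r(\mathcal D)=\mathrm h_r(\mathcal D)/|D|$; $\mathrm h_r(\mathbf P)=\{\mathrm h_r(\mathcal D):\mathcal D\in\mathbf P\}$. A set $M\subseteq\mathbb N^c$ is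 linear if $M=\{\bar v_0+a_1\bar v_1+\dots+a_k\bar v_k:a_i\in\mathbb N\}$ for some $\bar v_0,\dots,\bar v_k\in\mathbb N^c$; semilinear means a finite union of linear sets. $\mathrm{BDRD}_{+/- }$ distance: $\mathrm{dist}_{+/- }(\mathcal D,\mathcal D')$ is the minimum number of modifications (insert an element, delete an element together with all tuples containing it, insert a tuple, delete a tuple) applied to $\mathcal D$ and $\mathcal D'$ to make them isomorphic; they are $\epsilon$-close if this is at most $\epsilon d\min\{|D|,|D'|\}$, $\epsilon$-far otherwise; $\mathcal D$ is $\epsilon$-close to $\mathbf P$ if $\epsilon$-close to some member of $\mathbf P$, and $\epsilon$-far from $\mathbf P$ otherwise.
   Formalization: The given parameters ε and λ in (0,1] are taken to be rational rather than real (hyperfiniteness is correspondingly assumed only for rational values), and f and μ are found as rationals. -}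

module Defs where

open import Data.Nat using (ℕ; zero; suc; _+_; _*_; _∸_; _≤_; _⊓_; ∣_-_∣)
open import Data.Integer using (+_)
open import Data.Rational using (ℚ; _/_; 0ℚ)
import Data.Rational as Q
open import Data.Bool using (Bool; true; false; _∧_; if_then_else_)
open import Data.Fin using (Fin; zero; suc; punchIn; _≟_)
open import Data.Vec using (Vec; []; _∷_; map)
open import Data.Vec.Properties using (≡-dec)
open import Data.Vec.Membership.Propositional using () renaming (_∈_ to _∈ᵥ_)
open import Data.List using (List; []; _∷_; length; concatMap; allFin)
import Data.List as List
open import Data.List.Membership.Propositional using (_∈_)
open import Data.List.Relation.Unary.All using (All)
open import Data.List.Relation.Unary.Any using (Any)
open import Data.List.Relation.Unary.Unique.Propositional using (Unique)
open import Data.Maybe using (Maybe; just; nothing; maybe)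
open import Data.Product using (Σ; ∃; _×_; _,_; proj₁; proj₂)
open import Relation.Nullary using (¬_; yes; no)
open import Relation.Nullary.Decidable using (⌊_⌋)
open import Relation.Binary.PropositionalEquality using (_≡_; _≢_; refl)
open import Function.Bundles using (_⤖_; Bijection)
open import Function.Definitions using (Injective)

ℕtoℚ : ℕ → ℚ
ℕtoℚ n = + n / 1

-- a / n as a rational; convention a / 0 = 0 (only used for empty databases)
frac : ℕ → ℕ → ℚ
frac a zero    = 0ℚ
frac a (suc m) = + a / suc m

sumℕ : ∀ {c} → (Fin c → ℕ) → ℕ
sumℕ {zero}  f = 0
sumℕ {suc c} f = f zero + sumℕ (λ i → f (suc i))

sumℚ : ∀ {c} → (Fin c → ℚ) → ℚ
sumℚ {zero}  f = 0ℚ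
sumℚ {suc c} f = f zero Q.+ sumℚ (λ i → f (suc i))

countB : ∀ {A : Set} → List A → (A → Bool) → ℕ
countB []       p = 0
countB (x ∷ xs) p = (if p x then 1 else 0) + countB xs p

allVecs : ∀ n k → List (Vec (Fin n) k)
allVecs n zero    = [] ∷ []
allVecs n (suc k) = concatMap (λ x → List.map (x ∷_) (allVecs n k)) (allFin n)

elemᵇ : ∀ {n k} → Fin n → Vec (Fin n) k → Bool
elemᵇ a []       = false
elemᵇ a (x ∷ xs) = if ⌊ a ≟ x ⌋ then true else elemᵇ a xs

record Schema : Set where
  field
    nrel : ℕ
    ar   : Fin nrel → ℕ
open Schema public

record DB (σ : Schema) (n : ℕ) : Set where
  field
    rel : (R : Fin (nrel σ)) → Vec (Fin n) (ar σ R) → Bool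
open DB public

DBs : Schema → Set
DBs σ = Σ ℕ (DB σ)

size : ∀ {σ} → DBs σ → ℕ
size = proj₁

db : ∀ {σ} (X : DBs σ) → DB σ (size X)
db = proj₂

module _ {σ : Schema} where

  ntuples : ∀ {n} → DB σ n → ℕ
  ntuples {n} D = sumℕ (λ R → countB (allVecs n (ar σ R)) (rel D R))

  deg : ∀ {n} → DB σ n → Fin n → ℕ
  deg {n} D a = sumℕ (λ R → countB (allVecs n (ar σ R)) (λ t → rel D R t ∧ elemᵇ a t))

  DegreeAtMost : ℕ → ∀ {n} → DB σ n → Set
  DegreeAtMost d D = ∀ a → deg D a ≤ d

  Edge : ∀ {n} → DB σ n → Fin n → Fin n → Set
  Edge D a b = a ≢ b × Σ (Fin (nrel σ)) λ R → Σ (Vec _ (ar σ R)) λ t →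
               rel D R t ≡ true × a ∈ᵥ t × b ∈ᵥ t

  data Dist≤ {n} (D : DB σ n) : ℕ → Fin n → Fin n → Set where
    here : ∀ {r a} → Dist≤ D r a a
    step : ∀ {r a b c} → Dist≤ D r a b → Edge D b c → Dist≤ D (suc r) a c

  Connected : ∀ {n} → DB σ n → Fin n → Fin n → Set
  Connected D a b = ∃ λ r → Dist≤ D r a b

  SubDB : ∀ {n} → DB σ n → DB σ n → Set
  SubDB D' D = ∀ R t → rel D' R t ≡ true → rel D R t ≡ true

  Iso : DBs σ → DBs σ → Set
  Iso (n , D) (m , E) = Σ (Fin n ⤖ Fin m) λ f →
    ∀ R t → rel D R t ≡ rel E R (map (Bijection.to f) t)

  Rooted : Set
  Rooted = Σ ℕ λ m → DB σ m × Fin m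

  RIso : Rooted → Rooted → Set
  RIso (n , D , a) (m , E , b) = Σ (Fin n ⤖ Fin m) λ f →
    Bijection.to f a ≡ b × (∀ R t → rel D R t ≡ rel E R (map (Bijection.to f) t))

  IsNeighbourhood : ℕ → Rooted → Set
  IsNeighbourhood r (m , E , e) = ∀ b → Dist≤ E r e b

  -- NbIso D r a T : the r-neighbourhood (D[N_r(a)], a) is isomorphic to T
  -- (f is an isomorphism from T onto the induced sub-database on N_r(a))
  NbIso : ∀ {n} → DB σ n → ℕ → Fin n → Rooted → Set
  NbIso {n} D r a (m , E , e) = Σ (Fin m → Fin n) λ f →
    Injective _≡_ _≡_ f
    × (∀ b → (Dist≤ D r a b → ∃ λ x → f x ≡ b) × ((∃ λ x → f x ≡ b) → Dist≤ D r a b))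
    × f e ≡ a
    × (∀ R t → rel E R t ≡ rel D R (map f t))

  record TypeEnum (d r : ℕ) {c : ℕ} (L : Fin c → Rooted) : Set where
    field
      isType   : ∀ i → IsNeighbourhood r (L i) × DegreeAtMost d (proj₁ (proj₂ (L i)))
      distinct : ∀ i j → RIso (L i) (L j) → i ≡ j
      complete : ∀ T → IsNeighbourhood r T → DegreeAtMost d (proj₁ (proj₂ T)) →
                 ∃ λ i → RIso T (L i)

Card : ∀ {n} → (Fin n → Set) → ℕ → Set
Card {n} P k = Σ (List (Fin n)) λ xs →
  Unique xs × length xs ≡ k × (∀ a → (a ∈ xs → P a) × (P a → a ∈ xs))

module _ {σ : Schema} where

  IsHist : ℕ → ∀ {c} → (Fin c → Rooted {σ}) → ∀ {n} → DB σ n → (Fin c → ℕ) → Set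
  IsHist r L D h = ∀ i → Card (λ a → NbIso D r a (L i)) (h i)

  HistSet : ℕ → ∀ {c} → (Fin c → Rooted {σ}) → (DBs σ → Set) → (Fin c → ℕ) → Set
  HistSet r L P h = ∃ λ X → P X × IsHist r L (db X) h

l1ℕ : ∀ {c} → (Fin c → ℕ) → (Fin c → ℕ) → ℕ
l1ℕ h h' = sumℕ (λ i → ∣ h i - h' i ∣)

l1dv : ∀ {c} → ℕ → (Fin c → ℕ) → ℕ → (Fin c → ℕ) → ℚ
l1dv n h n' h' = sumℚ (λ i → Q.∣ frac (h i) n Q.- frac (h' i) n' ∣)

LinearSet : ℕ → Set
LinearSet c = Σ ℕ λ k → (Fin c → ℕ) × (Fin k → Fin c → ℕ)

InLinear : ∀ {c} → LinearSet c → (Fin c → ℕ) → Set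
InLinear (k , v₀ , v) x = ∃ λ (a : Fin k → ℕ) → ∀ j → x j ≡ v₀ j + sumℕ (λ i → a i * v i j)

Semilinear : ∀ {c} → ((Fin c → ℕ) → Set) → Set
Semilinear {c} M = Σ (List (LinearSet c)) λ Ls →
  ∀ x → (M x → Any (λ l → InLinear l x) Ls) × (Any (λ l → InLinear l x) Ls → M x)

module _ {σ : Schema} where

  IsoClosed : (DBs σ → Set) → Set
  IsoClosed P = ∀ X Y → Iso X Y → P X → P Y

  ClosedUnderRemovingTuples : (DBs σ → Set) → Set
  ClosedUnderRemovingTuples C = ∀ n (D D' : DB σ n) → SubDB D' D → C (n , D) → C (n , D')

  Partition : ℚ → ℕ → ∀ {n} → DB σ n → DB σ n → Set
  Partition ε k {n} D D' =
    SubDB D' D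
    × ℕtoℚ (ntuples D ∸ ntuples D') Q.≤ ε Q.* ℕtoℚ n
    × (∀ a (xs : List (Fin n)) → Unique xs → All (Connected D' a) xs → length xs ≤ k)

  Hyperfinite : (C P : DBs σ → Set) → Set
  Hyperfinite C P = Σ (ℚ → ℕ) λ ρ → ∀ ε → 0ℚ Q.< ε → ε Q.≤ Q.1ℚ →
    ∀ X → P X → Σ (DB σ (size X)) λ D' → Partition ε (ρ ε) (db X) D' × C (size X , D')

  setT : ∀ {n} → DB σ n → (R₀ : Fin (nrel σ)) → Vec (Fin n) (ar σ R₀) → Bool → DB σ n
  rel (setT D R₀ t₀ b) R t with R ≟ R₀
  ... | yes refl = if ⌊ ≡-dec _≟_ t t₀ ⌋ then b else rel D R t
  ... | no _     = rel D R t

  removeElem : ∀ {n} → Fin (suc n) → DB σ (suc n) → DB σ n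
  rel (removeElem i D) R t = rel D R (map (punchIn i) t)

  strip : ∀ {n k} → Vec (Fin (suc n)) k → Maybe (Vec (Fin n) k)
  strip []             = just []
  strip (zero ∷ xs)    = nothing
  strip (suc x ∷ xs) with strip xs
  ... | just ys = just (x ∷ ys)
  ... | nothing = nothing

  -- add a fresh element (the new element zero lies in no tuple)
  addElem : ∀ {n} → DB σ n → DB σ (suc n)
  rel (addElem D) R t = maybe (rel D R) false (strip t)

  data Step : DBs σ → DBs σ → Set where
    insTuple : ∀ {n} (D : DB σ n) R t → Step (n , D) (n , setT D R t true)
    delTuple : ∀ {n} (D : DB σ n) R t → Step (n , D) (n , setT D R t false)
    insElem  : ∀ {n} (D : DB σ n) → Step (n , D) (suc n , addElem D)
    delElem  : ∀ {n} (D : DB σ (suc n)) i → Step (suc n , D) (n , removeElem i D)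

  data Steps : ℕ → DBs σ → DBs σ → Set where
    done : ∀ {X} → Steps 0 X X
    more : ∀ {k X Y Z} → Step X Y → Steps k Y Z → Steps (suc k) X Z

  Close : ℚ → ℕ → DBs σ → DBs σ → Set
  Close ε d X Y = Σ ℕ λ k₁ → Σ ℕ λ k₂ → Σ (DBs σ) λ X' → Σ (DBs σ) λ Y' →
    Steps k₁ X X' × Steps k₂ Y Y' × Iso X' Y'
    × ℕtoℚ (k₁ + k₂) Q.≤ ε Q.* ℕtoℚ d Q.* ℕtoℚ (size X ⊓ size Y)

  CloseTo : ℚ → ℕ → (DBs σ → Set) → DBs σ → Set
  CloseTo ε d P X = ∃ λ Y → P Y × Close ε d X Y

  FarFrom : ℚ → ℕ → (DBs σ → Set) → DBs σ → Set
  FarFrom ε d P X = ¬ CloseTo ε d P X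

{-# OPTIONS --safe #-}
-- A point v₀ + Σ aᵢ vᵢ of size n of a semilinear set M is rescaled to size about N by replacing each
-- aᵢ with ⌊aᵢ N / n⌋: this stays in M and costs an error, relative to the exact rescaling, that is
-- bounded by a constant K of M.  With 1/q ≤ λ, sizes at least n_min > 16 K q make K negligible.
-- Rescaling the histogram of a large member of P down to size n_min + K gives (1) with distance at
-- most 1/(8q).  Rescaling the histogram of a small member of P up to the size of 𝒟 gives (2): if the
-- two distributions were within 3/(8q), then 𝒟 would be λ-close in histogram to a member of P,
-- hence ε-close to P.
-- Constructively the histogram of a large member must be computed; the type of an element is found
-- by building its ball and asking the completeness of the enumeration of types.
module Submission where

open import Defs
open import Data.Nat as ℕ using (ℕ; zero; suc; _≤_; _<_; _⊓_; z≤n; s≤s; ∣_-_∣; NonZero)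
import Data.Nat.Properties as ℕ
open import Data.Nat.DivMod using (m≡m%n+[m/n]*n; m%n≤n)
open import Data.Nat.ListAction using (sum)
open import Data.Nat.Tactic.RingSolver using (solve-∀)
import Data.Integer as ℤ
import Data.Integer.Properties as ℤ
open import Data.Integer using (-[1+_]; _⊖_)
open import Data.Integer.Tactic.RingSolver using () renaming (solve-∀ to ℤ-solve-∀)
import Data.Rational as ℚ
import Data.Rational.Properties as ℚ
open import Data.Rational using (ℚ; 0ℚ; 1ℚ; mkℚ; toℚᵘ) renaming (_≤_ to _≤ℚ_; _<_ to _<ℚ_)
import Data.Rational.Unnormalised as ℚᵘ
import Data.Rational.Unnormalised.Properties as ℚᵘ
open import Data.Rational.Unnormalised using (mkℚᵘ; *≡*; *≤*; _≃_)
open import Data.Bool using (true; false; _∧_)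
import Data.Bool.Properties as Bool
open import Data.Fin using (Fin; zero; suc; _≟_)
import Data.Fin.Properties as Fin
open import Data.Vec as Vec using (Vec; []; _∷_; map)
open import Data.Vec.Properties using (map-∘; map-cong; map-id)
open import Data.Vec.Membership.Propositional using () renaming (_∈_ to _∈ᵥ_)
import Data.Vec.Membership.DecPropositional as VecDec
import Data.Vec.Relation.Unary.Any as VecAny
open import Data.List as List using (List; []; _∷_; length; filter; allFin; lookup; cartesianProductWith)
import Data.List.Properties as List
open import Data.List.Membership.Propositional using (_∈_; find; lose)
open import Data.List.Membership.Propositional.Properties
open import Data.List.Relation.Unary.All as All using ([]; _∷_)
open import Data.List.Relation.Unary.AllPairs using ([]; _∷_)
open import Data.List.Relation.Unary.Any as Any using (Any; here; there)
open import Data.List.Relation.Unary.Any.Properties using (lookup-index)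
open import Data.List.Relation.Unary.Unique.Propositional using (Unique)
import Data.List.Relation.Unary.Unique.Propositional.Properties as Unique
open import Data.Product using (Σ; ∃; _×_; _,_; proj₁; proj₂)
open import Data.Empty using (⊥-elim)
open import Function using (_∘_; id)
open import Function.Bundles using (Bijection; mk⤖)
open import Function.Definitions using (Injective)
open import Relation.Nullary using (Dec; yes; no; ¬_)
open import Relation.Nullary.Decidable using (map′; _×-dec_; ¬?)
open import Relation.Binary.PropositionalEquality

-- Finite sums and counting in lists

sumℕ-cong : ∀ {c} {f g : Fin c → ℕ} → (∀ i → f i ≡ g i) → sumℕ f ≡ sumℕ g
sumℕ-cong {zero}  e = refl
sumℕ-cong {suc c} e = cong₂ ℕ._+_ (e zero) (sumℕ-cong (e ∘ suc))

sumℕ-mono : ∀ {c} {f g : Fin c → ℕ} → (∀ i → f i ≤ g i) → sumℕ f ≤ sumℕ g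
sumℕ-mono {zero}  e = z≤n
sumℕ-mono {suc c} e = ℕ.+-mono-≤ (e zero) (sumℕ-mono (e ∘ suc))

sumℕ-zero : ∀ c → sumℕ {c} (λ _ → 0) ≡ 0
sumℕ-zero zero    = refl
sumℕ-zero (suc c) = sumℕ-zero c

lookup-injective : ∀ {A : Set} {xs : List A} → Unique xs → Injective _≡_ _≡_ (lookup xs)
lookup-injective (_ ∷ _) {zero}  {zero}  _  = refl
lookup-injective (p ∷ _) {zero}  {suc j} eq = ⊥-elim (All.lookup p (∈-lookup j) eq)
lookup-injective (p ∷ _) {suc i} {zero}  eq = ⊥-elim (All.lookup p (∈-lookup i) (sym eq))
lookup-injective (_ ∷ u) {suc i} {suc j} eq = cong suc (lookup-injective u eq)

-- Pigeonhole: each position in `xs` goes to a position of its image in `ys`, and this map between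
-- finite index sets is injective.
length-≤ : ∀ {A B : Set} {xs : List A} {ys : List B} (g : A → B) → Injective _≡_ _≡_ g →
  Unique xs → (∀ {x} → x ∈ xs → g x ∈ ys) → length xs ≤ length ys
length-≤ {xs = xs} {ys} g g-inj u sub = Fin.injective⇒≤ {f = pos} pos-inj
  where
  pos : Fin (length xs) → Fin (length ys)
  pos i = Any.index (sub (∈-lookup i))

  pos-inj : Injective _≡_ _≡_ pos
  pos-inj {i} {j} eq = lookup-injective u (g-inj (trans (lookup-index (sub (∈-lookup i)))
    (trans (cong (lookup ys) eq) (sym (lookup-index (sub (∈-lookup j)))))))

-- Makes histograms unique, so that bounds proved for one histogram of a database transfer to any
-- other.
Card-unique : ∀ {n} {P : Fin n → Set} {k l} → Card P k → Card P l → k ≡ l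
Card-unique (xs , u , refl , p) (ys , v , refl , q) = ℕ.≤-antisym
  (length-≤ id id u (λ {x} m → proj₂ (q x) (proj₁ (p x) m)))
  (length-≤ id id v (λ {x} m → proj₂ (p x) (proj₁ (q x) m)))

-- Enumerating, counting and mapping tuples

allVecs-suc : ∀ {n} k (zs : List (Fin n)) →
  List.concatMap (λ x → List.map (x ∷_) (allVecs n k)) zs ≡ cartesianProductWith _∷_ zs (allVecs n k)
allVecs-suc k []       = refl
allVecs-suc k (z ∷ zs) = cong (_ List.++_) (allVecs-suc k zs)

allVecs-unique : ∀ n k → Unique (allVecs n k)
allVecs-unique n zero    = [] ∷ []
allVecs-unique n (suc k) = subst Unique (sym (allVecs-suc k (allFin n)))
  (Unique.cartesianProductWith⁺ _∷_ (λ { refl → refl , refl }) (Unique.allFin⁺ n) (allVecs-unique n k))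

∈-allVecs : ∀ {n k} (t : Vec (Fin n) k) → t ∈ allVecs n k
∈-allVecs []              = Any.here refl
∈-allVecs {n} {suc k} (x ∷ t) = subst (x ∷ t ∈_) (sym (allVecs-suc k (allFin n)))
  (∈-cartesianProductWith⁺ _∷_ (∈-allFin x) (∈-allVecs t))

anyVec? : ∀ {n k} {P : Vec (Fin n) k → Set} → (∀ t → Dec (P t)) → Dec (∃ P)
anyVec? P? = map′ (λ a → let t , _ , p = find a in t , p) (λ (t , p) → lose (∈-allVecs t) p)
  (Any.any? P? (allVecs _ _))

countB-filter : ∀ {A : Set} (xs : List A) p →
  countB xs p ≡ length (filter (λ x → p x Bool.≟ true) xs)
countB-filter []       p = refl
countB-filter (x ∷ xs) p with p x
... | true  = cong suc (countB-filter xs p)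
... | false = countB-filter xs p

-- Both counts are lengths of filtered lists, so the pigeonhole bound `length-≤` applies.
countB-≤ : ∀ {A B : Set} {xs : List A} {ys : List B} {p q} (g : A → B) → Injective _≡_ _≡_ g →
  Unique xs → (∀ x → g x ∈ ys) → (∀ x → p x ≡ true → q (g x) ≡ true) → countB xs p ≤ countB ys q
countB-≤ {xs = xs} {ys} {p} {q} g g-inj u sub imp =
  subst₂ _≤_ (sym (countB-filter xs p)) (sym (countB-filter ys q))
    (length-≤ g g-inj (Unique.filter⁺ _ u)
      (λ {x} m → ∈-filter⁺ (λ y → q y Bool.≟ true) (sub x)
        (imp x (proj₂ (∈-filter⁻ (λ y → p y Bool.≟ true) {xs = xs} m)))))

module _ {m n : ℕ} {f : Fin m → Fin n} (f-inj : Injective _≡_ _≡_ f) where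

  map-injective : ∀ {k} → Injective _≡_ _≡_ (map {n = k} f)
  map-injective {x = []}    {[]}    eq = refl
  map-injective {x = x ∷ s} {y ∷ t} eq =
    cong₂ _∷_ (f-inj (cong Vec.head eq)) (map-injective (cong Vec.tail eq))

  elemᵇ-map : ∀ {k} a (t : Vec (Fin m) k) → elemᵇ (f a) (map f t) ≡ elemᵇ a t
  elemᵇ-map a []      = refl
  elemᵇ-map a (x ∷ t) with f a ≟ f x | a ≟ x
  ... | yes _ | yes _ = refl
  ... | no _  | no _  = elemᵇ-map a t
  ... | yes p | no q  = ⊥-elim (q (f-inj p))
  ... | no p  | yes q = ⊥-elim (p (cong f q))

  ∈-map-injective : ∀ {k a} (t : Vec (Fin m) k) → f a ∈ᵥ map f t → a ∈ᵥ t
  ∈-map-injective (x ∷ t) (VecAny.here eq) = VecAny.here (f-inj eq)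
  ∈-map-injective (x ∷ t) (VecAny.there p) = VecAny.there (∈-map-injective t p)

-- Lifts a tuple lying inside a ball to a tuple over the index set of the ball.
map-preimage : ∀ {m n k} (f : Fin m → Fin n) (t : Vec (Fin n) k) →
  (∀ b → b ∈ᵥ t → ∃ λ x → f x ≡ b) → ∃ λ s → map f s ≡ t
map-preimage f []      pre = [] , refl
map-preimage f (b ∷ t) pre =
  let x , p = pre b (VecAny.here refl)
      s , q = map-preimage f t (λ b' b'∈t → pre b' (VecAny.there b'∈t))
  in x ∷ s , cong₂ _∷_ p q

-- By induction on the list: a new element `x` lengthens the fibre over `τ x` by one and leaves all
-- others unchanged.
sumℕ-length-fibres : ∀ {A : Set} {c} (τ : A → Fin c) xs →
  sumℕ (λ i → length (filter (λ x → τ x ≟ i) xs)) ≡ length xs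
sumℕ-length-fibres {c = c} τ []       = sumℕ-zero c
sumℕ-length-fibres {c = c} τ (x ∷ xs) = trans (bump (τ x) _ _ hit miss) (cong suc (sumℕ-length-fibres τ xs))
  where
  bump : ∀ {c} (k : Fin c) (f g : Fin c → ℕ) → f k ≡ suc (g k) → (∀ i → k ≢ i → f i ≡ g i) →
    sumℕ f ≡ suc (sumℕ g)
  bump zero    f g p q = cong₂ ℕ._+_ p (sumℕ-cong (λ i → q (suc i) λ ()))
  bump (suc k) f g p q = trans
    (cong₂ ℕ._+_ (q zero λ ()) (bump k (f ∘ suc) (g ∘ suc) p (λ i k≢i → q (suc i) (k≢i ∘ Fin.suc-injective))))
    (ℕ.+-suc _ _)
  hit : length (filter (λ y → τ y ≟ τ x) (x ∷ xs)) ≡ suc (length (filter (λ y → τ y ≟ τ x) xs))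
  hit = cong length (List.filter-accept (λ y → τ y ≟ τ x) {xs = xs} refl)
  miss : ∀ i → τ x ≢ i → length (filter (λ y → τ y ≟ i) (x ∷ xs)) ≡ length (filter (λ y → τ y ≟ i) xs)
  miss i ne = cong length (List.filter-reject (λ y → τ y ≟ i) {xs = xs} ne)

-- Balls and neighbourhood types

module _ {σ : Schema} where

  Edge? : ∀ {n} (D : DB σ n) a b → Dec (Edge D a b)
  Edge? D a b = ¬? (a ≟ b) ×-dec Fin.any? λ R → anyVec? λ t →
    (rel D R t Bool.≟ true) ×-dec (a ∈? t ×-dec b ∈? t)
    where open VecDec _≟_ using (_∈?_)

  Dist≤? : ∀ {n} (D : DB σ n) r a b → Dec (Dist≤ D r a b)
  Dist≤? D zero a b with a ≟ b
  ... | yes refl = yes here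
  ... | no a≢b   = no λ { here → a≢b refl }
  Dist≤? D (suc r) a c with a ≟ c | Fin.any? (λ b → Dist≤? D r a b ×-dec Edge? D b c)
  ... | yes refl | _             = yes here
  ... | no _     | yes (b , p , e) = yes (step p e)
  ... | no a≢c   | no ¬q         = no λ { here → a≢c refl ; (step p e) → ¬q (_ , p , e) }

  Dist≤-suc : ∀ {n} {D : DB σ n} {r a b} → Dist≤ D r a b → Dist≤ D (suc r) a b
  Dist≤-suc here       = here
  Dist≤-suc (step p e) = step (Dist≤-suc p) e

  Dist≤-mono : ∀ {n} {D : DB σ n} {r s a b} → r ≤ s → Dist≤ D r a b → Dist≤ D s a b
  Dist≤-mono _       here       = here
  Dist≤-mono (s≤s l) (step p e) = step (Dist≤-mono l p) e

  -- For injective `f` this is, up to isomorphism, the sub-database induced on the image of `f`.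
  pullback : ∀ {m n} → (Fin m → Fin n) → DB σ n → DB σ m
  rel (pullback f D) R t = rel D R (map f t)

  -- The tuples through `a` inject, by `map f`, into the tuples through `f a`.
  pullback-deg : ∀ {m n} {f : Fin m → Fin n} → Injective _≡_ _≡_ f → (D : DB σ n) →
    ∀ a → deg (pullback f D) a ≤ deg D (f a)
  pullback-deg {m} {f = f} f-inj D a = sumℕ-mono λ R →
    countB-≤ (map f) (map-injective f-inj) (allVecs-unique m _) (λ t → ∈-allVecs (map f t))
      (λ t eq → trans (cong (rel D R (map f t) ∧_) (elemᵇ-map f-inj a t)) eq)

  -- A path of length at most `r` from the centre stays in the ball, so it lifts edge by edge. The
  -- bound `s` decreases along the path while the radius `r` of the ball stays fixed.
  ball-isNeighbourhood : ∀ {m n} (D : DB σ n) r (f : Fin m → Fin n) → Injective _≡_ _≡_ f → ∀ e →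
    (∀ b → Dist≤ D r (f e) b → ∃ λ x → f x ≡ b) →
    ∀ {s} → s ≤ r → ∀ {x b} → f x ≡ b → Dist≤ D s (f e) b → Dist≤ (pullback f D) s e x
  ball-isNeighbourhood D r f f-inj e onto s≤r eq here with refl ← f-inj eq = here
  ball-isNeighbourhood D r f f-inj e onto {suc s} s<r {x} refl (step {b = b} p (b≢ , R , t , Rt , b∈t , c∈t)) =
    extend (map-preimage f t inBall) (onto b (Dist≤-mono (ℕ.<⇒≤ s<r) p))
    where
    -- all of the tuple witnessing the last edge lies in the ball, not only its two endpoints
    inBall : ∀ b' → b' ∈ᵥ t → ∃ λ y → f y ≡ b'
    inBall b' b'∈t with b ≟ b'
    ... | yes refl = onto b (Dist≤-mono (ℕ.<⇒≤ s<r) p)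
    ... | no b≢b'  = onto b' (Dist≤-mono s<r (step p (b≢b' , R , t , Rt , b∈t , b'∈t)))

    extend : (∃ λ t' → map f t' ≡ t) → (∃ λ y → f y ≡ b) → Dist≤ (pullback f D) (suc s) e x
    extend (t' , refl) (y , refl) = step
      (ball-isNeighbourhood D r f f-inj e onto (ℕ.<⇒≤ s<r) refl p)
      ((λ y≡x → b≢ (cong f y≡x)) , R , t' , Rt , ∈-map-injective f-inj t' b∈t , ∈-map-injective f-inj t' c∈t)

  -- The part of `NbIso` that does not mention relations; they are added afterwards by `pullback`.
  Ball : ∀ {n} → DB σ n → ℕ → Fin n → Set
  Ball {n} D r a = Σ ℕ λ m → Σ (Fin m → Fin n) λ f → Σ (Fin m) λ e → Injective _≡_ _≡_ f
    × (∀ b → (Dist≤ D r a b → ∃ λ x → f x ≡ b) × ((∃ λ x → f x ≡ b) → Dist≤ D r a b))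
    × f e ≡ a

  ball : ∀ {n} (D : DB σ n) r a → Ball D r a
  ball {n} D r a = length xs , lookup xs , Any.index (elem here)
    , lookup-injective (Unique.filter⁺ (Dist≤? D r a) (Unique.allFin⁺ n))
    , (λ b → (λ p → Any.index (elem p) , sym (lookup-index (elem p)))
           , λ { (x , refl) → proj₂ (∈-filter⁻ (Dist≤? D r a) {xs = allFin n} (∈-lookup x)) })
    , sym (lookup-index (elem here))
    where
    xs = filter (Dist≤? D r a) (allFin n)
    elem : ∀ {b} → Dist≤ D r a b → b ∈ xs
    elem p = ∈-filter⁺ (Dist≤? D r a) (∈-allFin _) p

  -- The embedding of `T` is precomposed with the inverse of the isomorphism.
  NbIso-resp : ∀ {n} {D : DB σ n} {r a} T T' → RIso T T' → NbIso D r a T → NbIso D r a T'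
  NbIso-resp {D = D} (m , E , e) (m' , E' , e') (g , ge , gR) (f , f-inj , f-im , fe , fR) =
      f ∘ g⁻¹
    , (λ {x} {y} eq → trans (sym (gg⁻¹ x)) (trans (cong to (f-inj eq)) (gg⁻¹ y)))
    , (λ b → (λ p → let x , eq = proj₁ (f-im b) p in to x , trans (cong f (g⁻¹g x)) eq)
           , λ (x , eq) → proj₂ (f-im b) (g⁻¹ x , eq))
    , trans (cong f (trans (cong g⁻¹ (sym ge)) (g⁻¹g e))) fe
    , λ R t → begin
        rel E' R t                        ≡⟨ cong (rel E' R) (map-id t) ⟨
        rel E' R (map id t)               ≡⟨ cong (rel E' R) (map-cong gg⁻¹ t) ⟨
        rel E' R (map (to ∘ g⁻¹) t)       ≡⟨ cong (rel E' R) (map-∘ to g⁻¹ t) ⟩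
        rel E' R (map to (map g⁻¹ t))     ≡⟨ gR R (map g⁻¹ t) ⟨
        rel E R (map g⁻¹ t)               ≡⟨ fR R (map g⁻¹ t) ⟩
        rel D R (map f (map g⁻¹ t))       ≡⟨ cong (rel D R) (map-∘ f g⁻¹ t) ⟨
        rel D R (map (f ∘ g⁻¹) t)         ∎
    where
    open ≡-Reasoning
    open Bijection g using (to; injective; surjective)
    g⁻¹ : Fin m' → Fin m
    g⁻¹ y = proj₁ (surjective y)
    gg⁻¹ : ∀ y → to (g⁻¹ y) ≡ y
    gg⁻¹ y = proj₂ (surjective y) refl
    g⁻¹g : ∀ x → g⁻¹ (to x) ≡ x
    g⁻¹g x = injective (gg⁻¹ (to x))

  -- Both embeddings have the same image, the ball around `a`, so one followed by the inverse of the
  -- other is an isomorphism.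
  NbIso⇒RIso : ∀ {n} {D : DB σ n} {r a} T T' → NbIso D r a T → NbIso D r a T' → RIso T T'
  NbIso⇒RIso {D = D} (m , E , e) (m' , E' , e') (f , f-inj , f-im , fe , fR) (f' , f'-inj , f'-im , fe' , fR') =
      mk⤖ (g-inj , g-surj) , f'-inj (trans (f'g e) (trans fe (sym fe')))
    , λ R t → begin
        rel E R t                   ≡⟨ fR R t ⟩
        rel D R (map f t)           ≡⟨ cong (rel D R) (map-cong f'g t) ⟨
        rel D R (map (f' ∘ g) t)    ≡⟨ cong (rel D R) (map-∘ f' g t) ⟩
        rel D R (map f' (map g t))  ≡⟨ fR' R (map g t) ⟨
        rel E' R (map g t)          ∎
    where
    open ≡-Reasoning
    pre : ∀ x → ∃ λ y → f' y ≡ f x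
    pre x = proj₁ (f'-im (f x)) (proj₂ (f-im (f x)) (x , refl))
    g : Fin m → Fin m'
    g x = proj₁ (pre x)
    f'g : ∀ x → f' (g x) ≡ f x
    f'g x = proj₂ (pre x)
    g-inj : Injective _≡_ _≡_ g
    g-inj {x} {y} eq = f-inj (trans (sym (f'g x)) (trans (cong f' eq) (f'g y)))
    g-surj : ∀ y → ∃ λ x → ∀ {z} → z ≡ x → g z ≡ y
    g-surj y = let x , eq = proj₁ (f-im (f' y)) (proj₂ (f'-im (f' y)) (y , refl)) in
      x , λ { refl → f'-inj (trans (f'g x) eq) }

  -- Computing the histogram

  module _ {d r c : ℕ} {L : Fin c → Rooted {σ}} (T : TypeEnum d r L) {n : ℕ} (D : DB σ n) (D≤d : DegreeAtMost d D) where
    open TypeEnum T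

    typeOf : ∀ a → ∃ λ i → NbIso D r a (L i)
    typeOf a = type-of-ball (ball D r a)
      where
      type-of-ball : Ball D r a → ∃ λ i → NbIso D r a (L i)
      type-of-ball (m , f , e , f-inj , f-im , refl) =
        let i , iso = complete B
              (λ b → ball-isNeighbourhood D r f f-inj e (λ b' → proj₁ (f-im b')) ℕ.≤-refl refl
                       (proj₂ (f-im (f b)) (b , refl)))
              (λ x → ℕ.≤-trans (pullback-deg f-inj D x) (D≤d (f x)))
        in i , NbIso-resp B (L i) iso (f , f-inj , f-im , refl , λ _ _ → refl)
        where B = m , pullback f D , e

    τ : Fin n → Fin c
    τ a = proj₁ (typeOf a)

    hist : Fin c → ℕ
    hist i = length (filter (λ a → τ a ≟ i) (allFin n))

    -- The fibre of `τ` over `i` contains every element of type `L i`: an element fitting both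
    -- `L (τ a)` and `L i` makes them isomorphic, and `distinct` identifies the indices.
    hist-isHist : IsHist r L D hist
    hist-isHist i = filter (λ a → τ a ≟ i) (allFin n) , Unique.filter⁺ _ (Unique.allFin⁺ n) , refl
      , λ a → (λ m → subst (NbIso D r a ∘ L) (proj₂ (∈-filter⁻ (λ a → τ a ≟ i) {xs = allFin n} m)) (proj₂ (typeOf a)))
            , λ nb → ∈-filter⁺ (λ a → τ a ≟ i) (∈-allFin a)
                (distinct (τ a) i (NbIso⇒RIso (L (τ a)) (L i) (proj₂ (typeOf a)) nb))

    -- Any histogram agrees with `hist`, whose entries are the sizes of the fibres of `τ`.
    IsHist-sum : ∀ {h} → IsHist r L D h → sumℕ h ≡ n
    IsHist-sum H = trans (sumℕ-cong λ i → Card-unique (H i) (hist-isHist i))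
      (trans (sumℕ-length-fibres τ (allFin n)) (List.length-tabulate id))

-- The operators of ℕ are scoped, since the theorem itself uses those of ℚ.
module _ where
  open import Data.Nat using (_+_; _*_; _/_; _%_)

  -- Sums and ℓ¹ distance of vectors of naturals

  sumℕ-+ : ∀ {c} (f g : Fin c → ℕ) → sumℕ (λ i → f i + g i) ≡ sumℕ f + sumℕ g
  sumℕ-+ {zero}  f g = refl
  sumℕ-+ {suc c} f g rewrite sumℕ-+ (f ∘ suc) (g ∘ suc) = interchange (f zero) (g zero) _ _
    where
    interchange : ∀ a b x y → a + b + (x + y) ≡ (a + x) + (b + y)
    interchange = solve-∀

  sumℕ-* : ∀ {c} a (f : Fin c → ℕ) → sumℕ (λ i → a * f i) ≡ a * sumℕ f
  sumℕ-* {zero}  a f = sym (ℕ.*-zeroʳ a)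
  sumℕ-* {suc c} a f = trans (cong (a * f zero +_) (sumℕ-* a (f ∘ suc))) (sym (ℕ.*-distribˡ-+ a (f zero) _))

  ∣+-+∣-≤ : ∀ a b x y → ∣ a + b - x + y ∣ ≤ ∣ a - x ∣ + ∣ b - y ∣
  ∣+-+∣-≤ a b x y = begin
    ∣ a + b - x + y ∣                       ≤⟨ ℕ.∣-∣-triangle (a + b) (x + b) (x + y) ⟩
    ∣ a + b - x + b ∣ + ∣ x + b - x + y ∣   ≡⟨ cong₂ _+_ (trans (cong₂ ∣_-_∣ (ℕ.+-comm a b) (ℕ.+-comm x b))
                                                 (ℕ.∣m+n-m+o∣≡∣n-o∣ b a x)) (ℕ.∣m+n-m+o∣≡∣n-o∣ x b y) ⟩
    ∣ a - x ∣ + ∣ b - y ∣                   ∎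
    where open ℕ.≤-Reasoning

  ∣sumℕ∣-≤ : ∀ {c} (f g : Fin c → ℕ) → ∣ sumℕ f - sumℕ g ∣ ≤ l1ℕ f g
  ∣sumℕ∣-≤ {zero}  f g = z≤n
  ∣sumℕ∣-≤ {suc c} f g = ℕ.≤-trans (∣+-+∣-≤ (f zero) _ (g zero) _)
    (ℕ.+-monoʳ-≤ _ (∣sumℕ∣-≤ (f ∘ suc) (g ∘ suc)))

  l1ℕ-sym : ∀ {c} (f g : Fin c → ℕ) → l1ℕ f g ≡ l1ℕ g f
  l1ℕ-sym f g = sumℕ-cong λ i → ℕ.∣-∣-comm (f i) (g i)

  l1ℕ-triangle : ∀ {c} (f g h : Fin c → ℕ) → l1ℕ f h ≤ l1ℕ f g + l1ℕ g h
  l1ℕ-triangle f g h = ℕ.≤-trans (sumℕ-mono λ i → ℕ.∣-∣-triangle (f i) (g i) (h i))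
    (ℕ.≤-reflexive (sumℕ-+ (λ i → ∣ f i - g i ∣) (λ i → ∣ g i - h i ∣)))

  l1ℕ-*ˡ : ∀ {c} m (f g : Fin c → ℕ) → l1ℕ (λ i → m * f i) (λ i → m * g i) ≡ m * l1ℕ f g
  l1ℕ-*ˡ m f g = trans (sumℕ-cong λ i → sym (ℕ.*-distribˡ-∣-∣ m (f i) (g i))) (sumℕ-* m (λ i → ∣ f i - g i ∣))

  l1ℕ-*ʳ : ∀ {c} m n (f : Fin c → ℕ) → l1ℕ (λ i → m * f i) (λ i → n * f i) ≡ ∣ m - n ∣ * sumℕ f
  l1ℕ-*ʳ m n f = trans (sumℕ-cong λ i → sym (ℕ.*-distribʳ-∣-∣ (f i) m n)) (sumℕ-* ∣ m - n ∣ f)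

  -- Rescaling points of linear and semilinear sets

  module _ {c : ℕ} where

    combination : (l : LinearSet c) → (Fin (proj₁ l) → ℕ) → Fin c → ℕ
    combination (k , v₀ , v) a j = v₀ j + sumℕ (λ i → a i * v i j)

    -- The error constant of one linear set: each entry of a period vector bounds the effect of
    -- rounding its coefficient, and `v₀` enters because it is not rescaled.
    weight : LinearSet c → ℕ
    weight (k , v₀ , v) = sumℕ (λ j → v₀ j + sumℕ (λ i → v i j))

    -- Only the coefficients are scaled by `N / n`, rounded down; keeping `v₀` fixed keeps the point
    -- in the linear set.
    rescale : ∀ n .{{_ : NonZero n}} → ℕ → (l : LinearSet c) → (Fin (proj₁ l) → ℕ) → Fin c → ℕ
    rescale n N l a = combination l (λ i → a i * N / n)

    ∣n*[b/n]-b∣≤n : ∀ n .{{_ : NonZero n}} b → ∣ n * (b / n) - b ∣ ≤ n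
    ∣n*[b/n]-b∣≤n n b = begin
      ∣ n * (b / n) - b ∣                            ≡⟨ cong₂ ∣_-_∣ (ℕ.*-comm n _)
                                                          (trans (m≡m%n+[m/n]*n b n) (ℕ.+-comm (b % n) _)) ⟩
      ∣ (b / n) * n - (b / n) * n + b % n ∣          ≡⟨ ℕ.∣m-m+n∣≡n ((b / n) * n) (b % n) ⟩
      b % n                                          ≤⟨ m%n≤n b n ⟩
      n                                              ∎
      where open ℕ.≤-Reasoning

    -- After multiplication by `n`, rounding moves each coefficient by at most `n`, and the unscaled
    -- `v₀` contributes with factor `∣ n - N ∣`. Both factors are at most `B`.
    rescale-l1 : ∀ n .{{_ : NonZero n}} N B → n ≤ B → N ≤ B → (l : LinearSet c) → ∀ a →
      l1ℕ (λ j → n * rescale n N l a j) (λ j → N * combination l a j) ≤ B * weight l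
    rescale-l1 n N B n≤B N≤B l@(k , v₀ , v) a = ℕ.≤-trans (sumℕ-mono coord)
      (ℕ.≤-reflexive (sumℕ-* B (λ j → v₀ j + sumℕ (λ i → v i j))))
      where
      open ℕ.≤-Reasoning
      b : Fin k → ℕ
      b i = a i * N / n
      rearrange : ∀ N a v → N * (a * v) ≡ a * N * v
      rearrange = solve-∀
      term : ∀ i j → ∣ n * (b i * v i j) - N * (a i * v i j) ∣ ≤ B * v i j
      term i j = begin
        ∣ n * (b i * v i j) - N * (a i * v i j) ∣    ≡⟨ cong₂ ∣_-_∣ (sym (ℕ.*-assoc n _ _)) (rearrange N (a i) (v i j)) ⟩
        ∣ n * b i * v i j - a i * N * v i j ∣        ≡⟨ ℕ.*-distribʳ-∣-∣ (v i j) (n * b i) (a i * N) ⟨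
        ∣ n * b i - a i * N ∣ * v i j                ≤⟨ ℕ.*-monoˡ-≤ (v i j) (ℕ.≤-trans (∣n*[b/n]-b∣≤n n (a i * N)) n≤B) ⟩
        B * v i j                                    ∎
      coord : ∀ j → ∣ n * rescale n N l a j - N * combination l a j ∣ ≤ B * (v₀ j + sumℕ (λ i → v i j))
      coord j = begin
        ∣ n * (v₀ j + sumℕ (λ i → b i * v i j)) - N * (v₀ j + sumℕ (λ i → a i * v i j)) ∣
          ≡⟨ cong₂ ∣_-_∣ (ℕ.*-distribˡ-+ n _ _) (ℕ.*-distribˡ-+ N _ _) ⟩
        ∣ n * v₀ j + n * sumℕ (λ i → b i * v i j) - N * v₀ j + N * sumℕ (λ i → a i * v i j) ∣
          ≤⟨ ∣+-+∣-≤ (n * v₀ j) _ (N * v₀ j) _ ⟩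
        ∣ n * v₀ j - N * v₀ j ∣ + ∣ n * sumℕ (λ i → b i * v i j) - N * sumℕ (λ i → a i * v i j) ∣
          ≡⟨ cong₂ _+_ (sym (ℕ.*-distribʳ-∣-∣ (v₀ j) n N)) 
               (cong₂ ∣_-_∣ (sym (sumℕ-* n (λ i → b i * v i j))) (sym (sumℕ-* N (λ i → a i * v i j)))) ⟩
        ∣ n - N ∣ * v₀ j + ∣ sumℕ (λ i → n * (b i * v i j)) - sumℕ (λ i → N * (a i * v i j)) ∣
          ≤⟨ ℕ.+-mono-≤ (ℕ.*-monoˡ-≤ (v₀ j) (ℕ.≤-trans (ℕ.∣m-n∣≤m⊔n n N) (ℕ.⊔-lub n≤B N≤B)))
               (ℕ.≤-trans (∣sumℕ∣-≤ (λ i → n * (b i * v i j)) (λ i → N * (a i * v i j))) (sumℕ-mono λ i → term i j)) ⟩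
        B * v₀ j + sumℕ (λ i → B * v i j)
          ≡⟨ trans (cong (B * v₀ j +_) (sumℕ-* B (λ i → v i j))) (sym (ℕ.*-distribˡ-+ B _ _)) ⟩
        B * (v₀ j + sumℕ (λ i → v i j)) ∎

    weights : List (LinearSet c) → ℕ
    weights = sum ∘ List.map weight

    weight-≤ : ∀ {l Ls} → l ∈ Ls → weight l ≤ weights Ls
    weight-≤ (here refl)          = ℕ.m≤m+n _ _
    weight-≤ {Ls = l' ∷ _} (there l∈Ls) = ℕ.≤-trans (weight-≤ l∈Ls) (ℕ.m≤n+m _ (weight l'))

    -- The sum of all weights serves whichever linear set contains `x`, so the error constant
    -- depends on the decomposition `S` alone.
    semilinear-rescale : ∀ {M : (Fin c → ℕ) → Set} (S : Semilinear M) {x} → M x →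
      ∀ n .{{_ : NonZero n}} N B → n ≤ B → N ≤ B →
      ∃ λ y → M y × l1ℕ (λ j → n * y j) (λ j → N * x j) ≤ B * weights (proj₁ S)
    semilinear-rescale (Ls , S) {x} Mx n N B n≤B N≤B
      with l , l∈Ls , a , eq ← find (proj₁ (S x) Mx) =
        rescale n N l a
      , proj₂ (S _) (lose l∈Ls ((λ i → a i * N / n) , λ j → refl))
      , ℕ.≤-trans (ℕ.≤-reflexive (sumℕ-cong λ j → cong (λ z → ∣ n * rescale n N l a j - N * z ∣) (eq j)))
          (ℕ.≤-trans (rescale-l1 n N B n≤B N≤B l a) (ℕ.*-monoʳ-≤ B (weight-≤ l∈Ls)))

    module _ {n n' N K : ℕ} .{{_ : NonZero n}} (x y : Fin c → ℕ)
      (x≡n : sumℕ x ≡ n) (y≡n' : sumℕ y ≡ n')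
      (approx : l1ℕ (λ j → n * y j) (λ j → N * x j) ≤ n * K) where

      open ℕ.≤-Reasoning

      -- The two vectors in `approx` have sums `n * n'` and `n * N`, and sums differ by at most the
      -- ℓ¹ distance; then `n` cancels.
      rescaled-size : ∣ n' - N ∣ ≤ K
      rescaled-size = ℕ.*-cancelˡ-≤ n (begin
        n * ∣ n' - N ∣                                ≡⟨ ℕ.*-distribˡ-∣-∣ n n' N ⟩
        ∣ n * n' - n * N ∣                            ≡⟨ cong₂ ∣_-_∣ (trans (cong (n *_) (sym y≡n')) (sym (sumℕ-* n y)))
                                                          (trans (ℕ.*-comm n N) (trans (cong (N *_) (sym x≡n)) (sym (sumℕ-* N x)))) ⟩
        ∣ sumℕ (λ j → n * y j) - sumℕ (λ j → N * x j) ∣ ≤⟨ ∣sumℕ∣-≤ (λ j → n * y j) (λ j → N * x j) ⟩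
        l1ℕ (λ j → n * y j) (λ j → N * x j)           ≤⟨ approx ⟩
        n * K                                         ∎)

      -- The detour through `N * x` costs `n * K` twice: once for the size being `n'` instead of
      -- `N`, once for the approximation.
      rescaled-dist : l1ℕ (λ j → n' * x j) (λ j → n * y j) ≤ 2 * (n * K)
      rescaled-dist = begin
        l1ℕ (λ j → n' * x j) (λ j → n * y j)          ≤⟨ l1ℕ-triangle (λ j → n' * x j) (λ j → N * x j) (λ j → n * y j) ⟩
        l1ℕ (λ j → n' * x j) (λ j → N * x j) + l1ℕ (λ j → N * x j) (λ j → n * y j)
          ≡⟨ cong₂ _+_ (trans (l1ℕ-*ʳ n' N x) (cong (∣ n' - N ∣ *_) x≡n)) (l1ℕ-sym (λ j → N * x j) (λ j → n * y j)) ⟩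
        ∣ n' - N ∣ * n + l1ℕ (λ j → n * y j) (λ j → N * x j) ≤⟨ ℕ.+-mono-≤ (ℕ.*-monoˡ-≤ n rescaled-size) approx ⟩
        K * n + n * K                                 ≡⟨ two K n ⟩
        2 * (n * K) ∎
        where
        two : ∀ K n → K * n + n * K ≡ 2 * (n * K)
        two = solve-∀

    -- Here `x` is the histogram of a large database, `y` that of a small one, and `z` is `y`
    -- rescaled to size about `n`. The assumption `8 * q * l1ℕ ... ≤ 3 * (n * m)` says that the
    -- distributions of `x` and `y` differ by at most `3/(8q)`.
    rescaled-close : ∀ {n m s q K : ℕ} .{{_ : NonZero m}} .{{_ : NonZero q}} (x y z : Fin c → ℕ) →
      sumℕ x ≡ n → sumℕ z ≡ s →
      l1ℕ (λ j → m * z j) (λ j → n * y j) ≤ n * K →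
      8 * q * l1ℕ (λ j → m * x j) (λ j → n * y j) ≤ 3 * (n * m) →
      16 * K * q ≤ m →
      q * l1ℕ z x ≤ s ℕ.⊓ n
    rescaled-close {n} {m} {s} {q} {K} x y z x≡n z≡s approx near K≤m = ℕ.⊓-glb qE≤s qE≤n
      where
      open ℕ.≤-Reasoning
      E S : ℕ
      E = l1ℕ z x
      S = l1ℕ (λ j → m * x j) (λ j → n * y j)

      mE≤ : m * E ≤ n * K + S
      mE≤ = begin
        m * E                                    ≡⟨ l1ℕ-*ˡ m z x ⟨
        l1ℕ (λ j → m * z j) (λ j → m * x j)      ≤⟨ l1ℕ-triangle (λ j → m * z j) (λ j → n * y j) (λ j → m * x j) ⟩
        l1ℕ (λ j → m * z j) (λ j → n * y j) + l1ℕ (λ j → n * y j) (λ j → m * x j)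
                                                 ≤⟨ ℕ.+-mono-≤ approx (ℕ.≤-reflexive (l1ℕ-sym (λ j → n * y j) (λ j → m * x j))) ⟩
        n * K + S                                ∎

      -- Of the budget `8 * (n * m)`, rescaling uses one share and the distance of the distributions
      -- six. The doubled left side is needed for `qE≤s`.
      2qE≤n : q * E + q * E ≤ n
      2qE≤n = ℕ.*-cancelˡ-≤ (8 * m) (begin
        8 * m * (q * E + q * E)                  ≡⟨ e₁ m q E ⟩
        16 * q * (m * E)                         ≤⟨ ℕ.*-monoʳ-≤ (16 * q) mE≤ ⟩
        16 * q * (n * K + S)                     ≡⟨ e₂ q n K S ⟩
        n * (16 * K * q) + 2 * (8 * q * S)       ≤⟨ ℕ.+-mono-≤ (ℕ.*-monoʳ-≤ n K≤m) (ℕ.*-monoʳ-≤ 2 near) ⟩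
        n * m + 2 * (3 * (n * m))                ≤⟨ ℕ.m≤m+n _ (n * m) ⟩
        n * m + 2 * (3 * (n * m)) + n * m        ≡⟨ e₃ n m ⟩
        8 * m * n                                ∎)
        where
        e₁ : ∀ m q E → 8 * m * (q * E + q * E) ≡ 16 * q * (m * E)
        e₁ = solve-∀
        e₂ : ∀ q n K S → 16 * q * (n * K + S) ≡ n * (16 * K * q) + 2 * (8 * q * S)
        e₂ = solve-∀
        e₃ : ∀ n m → n * m + 2 * (3 * (n * m)) + n * m ≡ 8 * m * n
        e₃ = solve-∀
        instance
          8m≢0 : NonZero (8 * m)
          8m≢0 = ℕ.m*n≢0 8 m

      qE≤n : q * E ≤ n
      qE≤n = ℕ.≤-trans (ℕ.m≤m+n (q * E) (q * E)) 2qE≤n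

      -- The size `s` falls short of `n` by at most `E`, hence by at most `q * E`, which the doubled
      -- bound absorbs.
      qE≤s : q * E ≤ s
      qE≤s = ℕ.+-cancelʳ-≤ (q * E) (q * E) s (begin
        q * E + q * E       ≤⟨ 2qE≤n ⟩
        n                   ≤⟨ ℕ.m≤n+∣n-m∣ n s ⟩
        s + ∣ s - n ∣       ≡⟨ cong₂ (λ a b → s + ∣ a - b ∣) z≡s x≡n ⟨
        s + ∣ sumℕ z - sumℕ x ∣ ≤⟨ ℕ.+-monoʳ-≤ s (∣sumℕ∣-≤ z x) ⟩
        s + E               ≤⟨ ℕ.+-monoʳ-≤ s (ℕ.m≤n*m E q) ⟩
        s + q * E           ∎)

  -- Comparing fractions through natural numbers

  toℚᵘ-frac : ∀ a n → toℚᵘ (frac a (suc n)) ≃ mkℚᵘ (ℤ.+ a) n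
  toℚᵘ-frac a n = ℚ.toℚᵘ-fromℚᵘ (mkℚᵘ (ℤ.+ a) n)

  frac-≤ : ∀ a b m n .{{_ : NonZero m}} .{{_ : NonZero n}} → a * n ≤ b * m → frac a m ℚ.≤ frac b n
  frac-≤ a b (suc m) (suc n) le = ℚ.toℚᵘ-cancel-≤
    (ℚᵘ.≤-respˡ-≃ (ℚᵘ.≃-sym (toℚᵘ-frac a m)) (ℚᵘ.≤-respʳ-≃ (ℚᵘ.≃-sym (toℚᵘ-frac b n))
      (*≤* (subst₂ ℤ._≤_ (ℤ.pos-* a (suc n)) (ℤ.pos-* b (suc m)) (ℤ.+≤+ le)))))

  frac-≤⁻¹ : ∀ a b m n .{{_ : NonZero m}} .{{_ : NonZero n}} → frac a m ℚ.≤ frac b n → a * n ≤ b * m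
  frac-≤⁻¹ a b (suc m) (suc n) le
    with *≤* p ← ℚᵘ.≤-respˡ-≃ (toℚᵘ-frac a m) (ℚᵘ.≤-respʳ-≃ (toℚᵘ-frac b n) (ℚ.toℚᵘ-mono-≤ le)) =
    ℤ.drop‿+≤+ (subst₂ ℤ._≤_ (sym (ℤ.pos-* a (suc n))) (sym (ℤ.pos-* b (suc m))) p)

  frac-< : ∀ a b m n .{{_ : NonZero m}} .{{_ : NonZero n}} → a * n < b * m → frac a m ℚ.< frac b n
  frac-< a b m n lt = ℚ.≰⇒> (ℕ.<⇒≱ lt ∘ frac-≤⁻¹ b a n m)

  frac-+ : ∀ a b m .{{_ : NonZero m}} → frac a m ℚ.+ frac b m ≡ frac (a + b) m
  frac-+ a b (suc m) = ℚ.toℚᵘ-injective (begin-equality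
    toℚᵘ (frac a (suc m) ℚ.+ frac b (suc m))              ≃⟨ ℚ.toℚᵘ-homo-+ (frac a (suc m)) (frac b (suc m)) ⟩
    toℚᵘ (frac a (suc m)) ℚᵘ.+ toℚᵘ (frac b (suc m))      ≃⟨ ℚᵘ.+-cong (toℚᵘ-frac a m) (toℚᵘ-frac b m) ⟩
    mkℚᵘ (ℤ.+ a) m ℚᵘ.+ mkℚᵘ (ℤ.+ b) m                        ≃⟨ *≡* (trans
      (same-denominator (ℤ.+ a) (ℤ.+ b) (ℤ.+ suc m))
      (cong (ℤ.+ (a + b) ℤ.*_) (sym (ℤ.pos-* (suc m) (suc m))))) ⟩
    mkℚᵘ (ℤ.+ (a + b)) m                                    ≃⟨ toℚᵘ-frac (a + b) m ⟨
    toℚᵘ (frac (a + b) (suc m))                           ∎)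
    where
    open ℚᵘ.≤-Reasoning
    same-denominator : ∀ a b m → (a ℤ.* m ℤ.+ b ℤ.* m) ℤ.* m ≡ (a ℤ.+ b) ℤ.* (m ℤ.* m)
    same-denominator = ℤ-solve-∀

  ∣⊖∣ : ∀ m n → ℤ.∣ m ⊖ n ∣ ≡ ∣ m - n ∣
  ∣⊖∣ zero    zero    = refl
  ∣⊖∣ zero    (suc n) = refl
  ∣⊖∣ (suc m) zero    = refl
  ∣⊖∣ (suc m) (suc n) = trans (cong ℤ.∣_∣ (ℤ.[1+m]⊖[1+n]≡m⊖n m n)) (∣⊖∣ m n)

  frac-dist : ∀ a b m n → ℚ.∣ frac a (suc m) ℚ.- frac b (suc n) ∣ ≡ frac ∣ suc n * a - suc m * b ∣ (suc m * suc n)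
  frac-dist a b m n = ℚ.toℚᵘ-injective (begin-equality
    toℚᵘ ℚ.∣ p ℚ.- q ∣                      ≃⟨ ℚ.toℚᵘ-homo-∣-∣ (p ℚ.- q) ⟩
    ℚᵘ.∣ toℚᵘ (p ℚ.- q) ∣                   ≃⟨ ℚᵘ.∣-∣-cong (ℚᵘ.≃-trans (ℚ.toℚᵘ-homo-+ p (ℚ.- q))
                                                 (ℚᵘ.+-cong (toℚᵘ-frac a m) (ℚᵘ.≃-trans (ℚ.toℚᵘ-homo‿- q) (ℚᵘ.-‿cong (toℚᵘ-frac b n))))) ⟩
    ℚᵘ.∣ mkℚᵘ (ℤ.+ a) m ℚᵘ.- mkℚᵘ (ℤ.+ b) n ∣   ≡⟨ cong (λ k → mkℚᵘ (ℤ.+ k) (n + m * suc n)) numerator ⟩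
    mkℚᵘ (ℤ.+ ∣ suc n * a - suc m * b ∣) (n + m * suc n) ≃⟨ toℚᵘ-frac _ (n + m * suc n) ⟨
    toℚᵘ (frac ∣ suc n * a - suc m * b ∣ (suc m * suc n)) ∎)
    where
    open ℚᵘ.≤-Reasoning
    p = frac a (suc m)
    q = frac b (suc n)
    numerator : ℤ.∣ ℤ.+ a ℤ.* ℤ.+ suc n ℤ.+ (ℤ.- (ℤ.+ b)) ℤ.* ℤ.+ suc m ∣ ≡ ∣ suc n * a - suc m * b ∣
    numerator = trans (cong ℤ.∣_∣ (trans (cong₂ ℤ._+_ (trans (sym (ℤ.pos-* a (suc n))) (cong ℤ.+_ (ℕ.*-comm a (suc n))))
        (trans (sym (ℤ.neg-distribˡ-* (ℤ.+ b) (ℤ.+ suc m)))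
          (cong ℤ.-_ (trans (sym (ℤ.pos-* b (suc m))) (cong ℤ.+_ (ℕ.*-comm b (suc m)))))))
        (ℤ.m-n≡m⊖n (suc n * a) (suc m * b))))
      (∣⊖∣ (suc n * a) (suc m * b))

  sumℚ-frac : ∀ {c} (g : Fin c → ℚ) (f : Fin c → ℕ) m →
    (∀ i → g i ≡ frac (f i) (suc m)) → sumℚ g ≡ frac (sumℕ f) (suc m)
  sumℚ-frac {zero}  g f m e = ℚ.toℚᵘ-injective (ℚᵘ.≃-trans (*≡* refl) (ℚᵘ.≃-sym (toℚᵘ-frac 0 m)))
  sumℚ-frac {suc c} g f m e = trans (cong₂ ℚ._+_ (e zero) (sumℚ-frac (g ∘ suc) (f ∘ suc) m (e ∘ suc)))
    (frac-+ (f zero) (sumℕ (f ∘ suc)) (suc m))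

  -- Over the common denominator, the product of the sizes, the distance of distributions is a
  -- single fraction, so comparing it with a constant becomes an inequality of naturals.
  l1dv-frac : ∀ {c} m n (x y : Fin c → ℕ) →
    l1dv (suc m) x (suc n) y ≡ frac (l1ℕ (λ i → suc n * x i) (λ i → suc m * y i)) (suc m * suc n)
  l1dv-frac m n x y = sumℚ-frac (λ i → ℚ.∣ frac (x i) (suc m) ℚ.- frac (y i) (suc n) ∣)
    (λ i → ∣ suc n * x i - suc m * y i ∣) (n + m * suc n) (λ i → frac-dist (x i) (y i) m n)

  -- A positive rational is at least the reciprocal of its denominator.
  ℕtoℚ-≤-* : ∀ p → 0ℚ ℚ.< p → ∀ {l k} → ℚ.denominatorℕ p * l ≤ k → ℕtoℚ l ℚ.≤ p ℚ.* ℕtoℚ k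
  ℕtoℚ-≤-* p@(mkℚ (ℤ.+ suc a) e _) pos {l} {k} le = ℚ.toℚᵘ-cancel-≤
    (ℚᵘ.≤-respˡ-≃ (ℚᵘ.≃-sym (toℚᵘ-frac l 0)) (ℚᵘ.≤-respʳ-≃
      (ℚᵘ.≃-sym (ℚᵘ.≃-trans (ℚ.toℚᵘ-homo-* p (ℕtoℚ k)) (ℚᵘ.*-congˡ {toℚᵘ p} (toℚᵘ-frac k 0))))
      (*≤* (subst₂ ℤ._≤_ (ℤ.pos-* l (suc e * 1)) 
        (trans (ℤ.pos-* (suc a * k) 1) (cong (ℤ._* ℤ.+ 1) (ℤ.pos-* (suc a) k))) (ℤ.+≤+ bound)))))
    where
    open ℕ.≤-Reasoning
    bound : l * (suc e * 1) ≤ suc a * k * 1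
    bound = begin
      l * (suc e * 1) ≡⟨ trans (cong (l *_) (ℕ.*-identityʳ (suc e))) (ℕ.*-comm l (suc e)) ⟩
      suc e * l       ≤⟨ le ⟩
      k               ≤⟨ ℕ.m≤n*m k (suc a) ⟩
      suc a * k       ≡⟨ ℕ.*-identityʳ (suc a * k) ⟨
      suc a * k * 1   ∎
  ℕtoℚ-≤-* (mkℚ (ℤ.+ 0) e _) (ℚ.*<* (ℤ.+<+ ())) le
  ℕtoℚ-≤-* (mkℚ -[1+ _ ] e _) (ℚ.*<* ()) le

  -- The constants and the two halves of the theorem

  -- The hypothesis near is the robustness assumption on r and λ, with λ replaced by the smaller 1/q.
  module Tester {σ : Schema} {d r c : ℕ} {C P Near : DBs σ → Set} {L : Fin c → Rooted {σ}}
    (C≤d : ∀ X → C X → DegreeAtMost d (db X)) (P⊆C : ∀ X → P X → C X) (T : TypeEnum d r L)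
    (S : Semilinear (HistSet r L P)) (q-1 : ℕ)
    (near : ∀ X Y → P X → C Y → ∀ h h' → IsHist r L (db X) h → IsHist r L (db Y) h' →
      suc q-1 * l1ℕ h h' ≤ size X ⊓ size Y → Near Y) where

    -- A rescaling aimed at size `nmin + K` misses it by at most `K`, so it lands between `nmin` and
    -- `nmax`.
    q K nmin nmax : ℕ
    q    = suc q-1
    K    = weights (proj₁ S)
    nmin = suc (16 * K * q)
    nmax = nmin + K + K

    -- Chosen so that `f - μ` is `1/(8q)`, the bound reached by scaling down, and `f + μ` is
    -- `3/(8q)`, the tolerance of `rescaled-close`.
    f μ : ℚ
    f = frac 2 (8 * q)
    μ = frac 1 (8 * q)

    f-μ : f ℚ.- μ ≡ frac 1 (8 * q)
    f-μ = begin
      f ℚ.- μ              ≡⟨ cong (ℚ._- μ) (frac-+ 1 1 (8 * q)) ⟨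
      (μ ℚ.+ μ) ℚ.- μ      ≡⟨ ℚ.+-assoc μ μ (ℚ.- μ) ⟩
      μ ℚ.+ (μ ℚ.- μ)      ≡⟨ cong (μ ℚ.+_) (ℚ.+-inverseʳ μ) ⟩
      μ ℚ.+ 0ℚ             ≡⟨ ℚ.+-identityʳ μ ⟩
      μ                    ∎
      where open ≡-Reasoning

    positive : ∀ a → 0ℚ <ℚ frac (suc a) (8 * q)
    positive a = frac-< 0 (suc a) 1 (8 * q) (s≤s z≤n)

    below-1 : ∀ a → a < 8 → frac a (8 * q) <ℚ 1ℚ
    below-1 a a<8 = frac-< a 1 (8 * q) 1 (subst₂ _<_ (sym (ℕ.*-identityʳ a)) (sym (ℕ.*-identityˡ (8 * q)))
      (ℕ.<-≤-trans a<8 (ℕ.m≤m*n 8 q)))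

    total : ∀ X → C X → ∀ {h} → IsHist r L (db X) h → sumℕ h ≡ size X
    total X CX = IsHist-sum T (db X) (C≤d X CX)

    approximable : ∀ X → C X → nmax < size X → P X → ∃ λ Y → P Y × nmin ≤ size Y × size Y ≤ nmax ×
      (∀ h h' → IsHist r L (db X) h → IsHist r L (db Y) h' → l1dv (size X) h (size Y) h' ≤ℚ f ℚ.- μ)
    approximable X@(n@(suc _) , D) CX n>nmax PX =
      -- The target size is below `n`, so `B = n` is admissible and the error is `n * K`.
      from-rescaling (semilinear-rescale S (X , PX , x-hist) n (nmin + K) n ℕ.≤-refl
        (ℕ.≤-trans (ℕ.m≤m+n (nmin + K) K) (ℕ.<⇒≤ n>nmax)))
      where
      x : Fin c → ℕ
      x = hist T D (C≤d X CX)
      x-hist : IsHist r L D x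
      x-hist = hist-isHist T D (C≤d X CX)

      bound : ∀ (Y : DBs σ) h h' → sumℕ h ≡ n → sumℕ h' ≡ size Y → nmin ≤ size Y →
        l1ℕ (λ j → n * h' j) (λ j → (nmin + K) * h j) ≤ n * K → l1dv n h (size Y) h' ≤ℚ f ℚ.- μ
      -- As `nmin` is a successor, `Y` is nonempty and the default value of `frac` at denominator 0
      -- does not arise.
      bound (suc m' , _) h h' Σh Σh' nmin≤m approx =
        subst₂ _≤ℚ_ (sym (l1dv-frac _ m' h h')) (sym f-μ) (frac-≤ E 1 (n * suc m') (8 * q) (begin
          E * (8 * q)                ≤⟨ ℕ.*-monoˡ-≤ (8 * q) (rescaled-dist {n = n} {N = nmin + K} h h' Σh Σh' approx) ⟩
          2 * (n * K) * (8 * q)      ≡⟨ regroup n K q ⟩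
          n * (16 * K * q)           ≤⟨ ℕ.*-monoʳ-≤ n (ℕ.≤-trans (ℕ.n≤1+n _) nmin≤m) ⟩
          n * suc m'                 ≡⟨ ℕ.*-identityˡ (n * suc m') ⟨
          1 * (n * suc m')           ∎))
        where
        open ℕ.≤-Reasoning
        E : ℕ
        E = l1ℕ (λ j → suc m' * h j) (λ j → n * h' j)
        regroup : ∀ n K q → 2 * (n * K) * (8 * q) ≡ n * (16 * K * q)
        regroup = solve-∀

      from-rescaling : (∃ λ y → HistSet r L P y × l1ℕ (λ j → n * y j) (λ j → (nmin + K) * x j) ≤ n * K) →
        ∃ λ Y → P Y × nmin ≤ size Y × size Y ≤ nmax ×
          (∀ h h' → IsHist r L D h → IsHist r L (db Y) h' → l1dv n h (size Y) h' ≤ℚ f ℚ.- μ)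
      from-rescaling (y , (Y@(n' , _) , PY , y-hist) , approx) =
          Y , PY , nmin≤n'
        , ℕ.≤-trans (ℕ.m≤n+∣m-n∣ n' (nmin + K)) (ℕ.+-monoʳ-≤ (nmin + K) size-approx)
        , λ h h' H H' → bound Y h h' (total X CX H) (total Y (P⊆C Y PY) H') nmin≤n'
            -- The estimate for `x` and `y` passes to arbitrary histograms `h` and `h'` by
            -- uniqueness.
            (subst (_≤ n * K)
              (sumℕ-cong λ j → cong₂ (λ a b → ∣ n * a - (nmin + K) * b ∣)
                (Card-unique (y-hist j) (H' j)) (Card-unique (x-hist j) (H j)))
              approx)
        where
        size-approx : ∣ n' - nmin + K ∣ ≤ K
        size-approx = rescaled-size {n = n} x y (total X CX x-hist) (total Y (P⊆C Y PY) y-hist) approx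
        nmin≤n' : nmin ≤ n'
        nmin≤n' = ℕ.+-cancelʳ-≤ K nmin n'
          (ℕ.≤-trans (ℕ.m≤n+∣n-m∣ (nmin + K) n') (ℕ.+-monoʳ-≤ n' size-approx))

    -- By contraposition: if the distance were at most `3/(8q)`, the histogram of `Y` rescaled to
    -- size about that of `X` would be realised by some `Z` in `P`, and `near` would apply to `Z`
    -- and `X`.
    far : ∀ X → C X → nmax < size X → ¬ Near X → ∀ Y → P Y → nmin ≤ size Y → size Y ≤ nmax →
      ∀ h h' → IsHist r L (db X) h → IsHist r L (db Y) h' → f ℚ.+ μ <ℚ l1dv (size X) h (size Y) h'
    far X@(n@(suc _) , _) CX n>nmax X-far Y@(m@(suc _) , _) PY nmin≤m m≤nmax h h' H H' =
      subst₂ _<ℚ_ (sym (frac-+ 2 1 (8 * q))) (sym (l1dv-frac _ _ h h')) (ℚ.≰⇒> (X-far ∘ X-near))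
      where
      distance : ℕ
      distance = l1ℕ (λ j → m * h j) (λ j → n * h' j)

      X-near : frac distance (n * m) ≤ℚ frac 3 (8 * q) → Near X
      X-near le
        with z , (Z , PZ , z-hist) , approx ← semilinear-rescale S (Y , PY , H') m n n
               (ℕ.≤-trans m≤nmax (ℕ.<⇒≤ n>nmax)) ℕ.≤-refl =
        near Z X PZ CX z h z-hist H
          (rescaled-close {n = n} {m} {size Z} {q} {K} h h' z (total X CX H) (total Z (P⊆C Z PZ) z-hist) approx
            (ℕ.≤-trans (ℕ.≤-reflexive (ℕ.*-comm (8 * q) distance)) (frac-≤⁻¹ distance 3 (n * m) (8 * q) le))
            (ℕ.≤-trans (ℕ.n≤1+n _) nmin≤m))

open import Data.Rational using (_+_; _-_; _*_)

theorem4p1 : (σ : Schema) (d : ℕ) → 2 ≤ d →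
  (C P : DBs σ → Set) →
  (∀ X → C X → DegreeAtMost d (db X)) →
  ClosedUnderRemovingTuples C →
  IsoClosed P →
  (∀ X → P X → C X) →
  Hyperfinite C P →
  (ε : ℚ) → 0ℚ <ℚ ε → ε ≤ℚ 1ℚ →
  (r : ℕ) (lam : ℚ) → 0ℚ <ℚ lam → lam ≤ℚ 1ℚ →
  (c : ℕ) (L : Fin c → Rooted {σ}) → TypeEnum d r L →
  (∀ X Y → P X → C Y → ∀ h h' → IsHist r L (db X) h → IsHist r L (db Y) h' →
    ℕtoℚ (l1ℕ h h') ≤ℚ lam * ℕtoℚ (size X ⊓ size Y) → CloseTo ε d P Y) →
  Semilinear (HistSet r L P) →
  Σ ℕ λ nmin → Σ ℕ λ nmax → Σ ℚ λ f → Σ ℚ λ μ →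
    0ℚ <ℚ f × f <ℚ 1ℚ × 0ℚ <ℚ μ × μ <ℚ 1ℚ ×
    (∀ X → C X → nmax < size X →
      (P X → ∃ λ Y → P Y × nmin ≤ size Y × size Y ≤ nmax ×
          (∀ h h' → IsHist r L (db X) h → IsHist r L (db Y) h' →
            l1dv (size X) h (size Y) h' ≤ℚ f - μ))
      × (FarFrom ε d P X → ∀ Y → P Y → nmin ≤ size Y → size Y ≤ nmax →
          ∀ h h' → IsHist r L (db X) h → IsHist r L (db Y) h' →
            f + μ <ℚ l1dv (size X) h (size Y) h'))
theorem4p1 σ d _ C P C≤d _ _ P⊆C _ ε _ _ r lam 0<lam _ c L T robust S =
    nmin , nmax , f , μ
  , positive 1 , below-1 2 (ℕ.m≤m+n 3 5) , positive 0 , below-1 1 (ℕ.m≤m+n 2 6)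
  , λ X CX n>nmax → approximable X CX n>nmax , far X CX n>nmax
  where
  -- `q` is the denominator of `lam`; since `lam` is positive, `1/q ≤ lam`, and robustness for `lam`
  -- yields the hypothesis `near`.
  open Tester {Near = CloseTo ε d P} C≤d P⊆C T S (ℚ.ℚ.denominator-1 lam)
    (λ X Y PX CY h h' H H' le → robust X Y PX CY h h' H H' (ℕtoℚ-≤-* lam 0<lam le))
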